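{- Let $d\in\mathbb{N}$, let $A$ be a $d\times d$ reclusive matrix and let $\vec{c}\in\mathbb{Z}^{d}$. Then $\|A\vec{c}\|_{\infty}\leq 1$ if and only if $\vec{c}=\langle c_{j}\rangle_{j=1}^{d}$ is a weak-alt-1 sequence.
   Context: A $d\times d$ matrix $A=(a_{ij})$ is reclusive if $a_{ij}=0$ for $i>j$, $a_{ii}=1$ for all $i$, and $a_{ij}>a_{ik}>0$ whenever $i\le j<k$. A finite sequence $\langle c_i\rangle_{i=1}^n$ is alt-1 if it equals $\langle(-1)^i\rangle_{i=1}^n$ or $\langle(-1)^{i+1}\rangle_{i=1}^n$ (the empty sequence counts as alt-1). It is weak-alt-1 if every term is in $\{ -1,0,1\}$ and the subsequence of its nonzero terms is alt-1 (so the all-zero sequence is weak-alt-1). -}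

module Defs where

open import Level using (Level; _⊔_; suc)
open import Algebra.Bundles using (CommutativeRing)
open import Relation.Binary.Core using (Rel)
open import Relation.Binary.Structures using (IsStrictTotalOrder)
open import Data.Nat as ℕ using (ℕ; zero)
open import Data.Integer as ℤ using (ℤ; +_; -[1+_])
open import Data.Fin as Fin using (Fin)
open import Data.List using (List; []; _∷_; length; filter)
open import Data.List.Relation.Unary.All using (All)
open import Data.Product using (_×_)
open import Data.Sum using (_⊎_)
open import Relation.Binary.PropositionalEquality using (_≡_)
open import Relation.Nullary.Decidable using (¬?)
import Data.Vec.Functional as VF

-- An ordered commutative ring (the real numbers are an instance).
-- Standard axioms: strict total order compatible with + and with
-- multiplication of positives, and 0 < 1 (nontriviality).
record OrderedCommRing (c ℓ₁ ℓ₂ : Level) : Set (suc (c ⊔ ℓ₁ ⊔ ℓ₂)) where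
  field
    commutativeRing : CommutativeRing c ℓ₁
  open CommutativeRing commutativeRing public
  field
    _<_ : Rel Carrier ℓ₂
    isStrictTotalOrder : IsStrictTotalOrder _≈_ _<_
    +-mono-< : ∀ {x y} z → x < y → (x + z) < (y + z)
    *-pos : ∀ {x y} → 0# < x → 0# < y → 0# < (x * y)
    0<1 : 0# < 1#

  _≤_ : Rel Carrier (ℓ₁ ⊔ ℓ₂)
  x ≤ y = x < y ⊎ x ≈ y

  -- canonical embedding of ℕ and ℤ
  fromℕ : ℕ → Carrier
  fromℕ zero = 0#
  fromℕ (ℕ.suc n) = 1# + fromℕ n

  fromℤ : ℤ → Carrier
  fromℤ (+ n) = fromℕ n
  fromℤ -[1+ n ] = - fromℕ (ℕ.suc n)

  -- sum of a finite family
  ∑ : ∀ {n} → (Fin n → Carrier) → Carrier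
  ∑ {zero} f = 0#
  ∑ {ℕ.suc n} f = f Fin.zero + ∑ (λ i → f (Fin.suc i))

  Matrix : ℕ → Set c
  Matrix d = Fin d → Fin d → Carrier

  -- Reclusive matrix (rows indexed i, columns j)
  Reclusive : ∀ {d} → Matrix d → Set (ℓ₁ ⊔ ℓ₂)
  Reclusive {d} A =
    (∀ (i j : Fin d) → j Fin.< i → A i j ≈ 0#) ×
    (∀ (i : Fin d) → A i i ≈ 1#) ×
    (∀ (i j k : Fin d) → i Fin.≤ j → j Fin.< k → (A i k < A i j) × (0# < A i k))

  -- A c, for an integer vector c (embedded into the ring)
  mulVec : ∀ {d} → Matrix d → (Fin d → ℤ) → Fin d → Carrier
  mulVec A c i = ∑ (λ j → A i j * fromℤ (c j))

  -- ‖v‖∞ ≤ 1, i.e. |v_i| ≤ 1 for every i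
  InfNorm≤1 : ∀ {d} → (Fin d → Carrier) → Set (ℓ₁ ⊔ ℓ₂)
  InfNorm≤1 {d} v = ∀ (i : Fin d) → ((- 1#) ≤ v i) × (v i ≤ 1#)

-- alternating list s, -s, s, ... of length n
altList : ℤ → ℕ → List ℤ
altList s zero = []
altList s (ℕ.suc n) = s ∷ altList (ℤ.- s) n

-- alt-1: equals ⟨(-1)^i⟩_{i=1}^n (starts with -1) or ⟨(-1)^{i+1}⟩ (starts with 1)
Alt1 : List ℤ → Set
Alt1 xs = xs ≡ altList (ℤ.- ℤ.1ℤ) (length xs) ⊎ xs ≡ altList ℤ.1ℤ (length xs)

nonzeros : List ℤ → List ℤ
nonzeros = filter (λ x → ¬? (x ℤ.≟ ℤ.0ℤ))

WeakAlt1 : List ℤ → Set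
WeakAlt1 xs =
  All (λ x → x ≡ ℤ.- ℤ.1ℤ ⊎ x ≡ ℤ.0ℤ ⊎ x ≡ ℤ.1ℤ) xs × Alt1 (nonzeros xs)

-- the sequence ⟨c_j⟩_{j=1}^d as a list
seq : ∀ {d} → (Fin d → ℤ) → List ℤ
seq = VF.toList

module Submission where

-- Row i of A c is c_i + Σ_{j>i} a_ij c_j, with weights a_ij positive, strictly
-- decreasing in j and below a_ii = 1.  For a weak-alt-1 sequence such a weighted sum
-- behaves like an alternating series: it vanishes with the sequence, or it has the
-- sign of the first nonzero term and modulus at most that term's weight.  Applied to
-- whole rows this gives ‖A c‖∞ ≤ 1.  Conversely, by induction from the last row the
-- tail of c is weak-alt-1 and its part y of the first row has |y| < 1 with the sign t
-- of the first nonzero tail entry, so |c_0 + y| ≤ 1 forces c_0 ∈ {0, -t}.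

open import Defs
open import Level using (Level; _⊔_)
open import Data.Nat using (ℕ; zero; suc; z≤n; s≤s)
open import Data.Integer as ℤ using (ℤ; 0ℤ; _◃_; signAbs; _◂_)
open import Data.Sign as Sign using (Sign; opposite)
open import Data.Sign.Properties using (opposite-involutive)
open import Data.Fin as Fin using (Fin; zero; suc)
open import Data.List using (List; []; _∷_; length)
open import Data.List.Properties using (∷-injectiveʳ)
open import Data.List.Relation.Unary.All using (All; []; _∷_)
open import Data.Product using (_×_; _,_; ∃-syntax; proj₁; proj₂)
open import Data.Sum as Sum using (_⊎_; inj₁; inj₂)
open import Data.Empty using (⊥-elim)
open import Function using (_∘_)
open import Function.Bundles using (_⇔_; mk⇔; Equivalence)
open import Relation.Binary.Bundles using (StrictPartialOrder)
open import Relation.Binary.Structures using (IsStrictTotalOrder)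
open import Relation.Binary.PropositionalEquality using (_≡_; refl; sym; cong; subst)
open import Relation.Nullary using (¬_)

private
  variable
    s t : Sign
    x : ℤ
    xs : List ℤ

-- The sign s is that of the first nonzero entry; a list of zeros has both signs.
data WeakAlt : Sign → List ℤ → Set where
  []   : WeakAlt s []
  0∷_  : WeakAlt s xs → WeakAlt s (0ℤ ∷ xs)
  ±1∷_ : WeakAlt (opposite s) xs → WeakAlt s ((s ◃ 1) ∷ xs)

uncons : WeakAlt s (x ∷ xs) →
         (x ≡ 0ℤ × WeakAlt s xs) ⊎ (x ≡ s ◃ 1 × WeakAlt (opposite s) xs)
uncons (0∷ w)  = inj₁ (refl , w)
uncons (±1∷ w) = inj₂ (refl , w)

WeakAlt-tail : WeakAlt s (x ∷ xs) → ∃[ t ] WeakAlt t xs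
WeakAlt-tail (0∷ w)  = _ , w
WeakAlt-tail (±1∷ w) = _ , w

zeros⇒WeakAlt : All (_≡ 0ℤ) xs → WeakAlt s xs
zeros⇒WeakAlt []         = []
zeros⇒WeakAlt (refl ∷ z) = 0∷ zeros⇒WeakAlt z

same-or-opposite : ∀ s t → s ≡ t ⊎ s ≡ opposite t
same-or-opposite Sign.+ Sign.+ = inj₁ refl
same-or-opposite Sign.+ Sign.- = inj₂ refl
same-or-opposite Sign.- Sign.+ = inj₂ refl
same-or-opposite Sign.- Sign.- = inj₁ refl

Trit : ℤ → Set
Trit x = x ≡ ℤ.- ℤ.1ℤ ⊎ x ≡ ℤ.0ℤ ⊎ x ≡ ℤ.1ℤ

WeakAlt⇒trits : WeakAlt s xs → All Trit xs
WeakAlt⇒trits []               = []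
WeakAlt⇒trits (0∷ w)           = inj₂ (inj₁ refl) ∷ WeakAlt⇒trits w
WeakAlt⇒trits {Sign.+} (±1∷ w) = inj₂ (inj₂ refl) ∷ WeakAlt⇒trits w
WeakAlt⇒trits {Sign.-} (±1∷ w) = inj₁ refl ∷ WeakAlt⇒trits w

WeakAlt⇒nonzeros : WeakAlt s xs → nonzeros xs ≡ altList (s ◃ 1) (length (nonzeros xs))
WeakAlt⇒nonzeros []               = refl
WeakAlt⇒nonzeros (0∷ w)           = WeakAlt⇒nonzeros w
WeakAlt⇒nonzeros {Sign.+} (±1∷ w) = cong (_ ∷_) (WeakAlt⇒nonzeros w)
WeakAlt⇒nonzeros {Sign.-} (±1∷ w) = cong (_ ∷_) (WeakAlt⇒nonzeros w)

nonzeros⇒WeakAlt : ∀ s n → All Trit xs → nonzeros xs ≡ altList (s ◃ 1) n → WeakAlt s xs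
nonzeros⇒WeakAlt s n [] _ = []
nonzeros⇒WeakAlt s n (inj₂ (inj₁ refl) ∷ ts) e = 0∷ nonzeros⇒WeakAlt s n ts e
nonzeros⇒WeakAlt Sign.- (suc n) (inj₁ refl ∷ ts) e = ±1∷ nonzeros⇒WeakAlt Sign.+ n ts (∷-injectiveʳ e)
nonzeros⇒WeakAlt Sign.+ (suc n) (inj₂ (inj₂ refl) ∷ ts) e = ±1∷ nonzeros⇒WeakAlt Sign.- n ts (∷-injectiveʳ e)
nonzeros⇒WeakAlt Sign.- zero (inj₁ refl ∷ _) ()
nonzeros⇒WeakAlt Sign.+ zero (inj₁ refl ∷ _) ()
nonzeros⇒WeakAlt Sign.+ (suc n) (inj₁ refl ∷ _) ()
nonzeros⇒WeakAlt Sign.+ zero (inj₂ (inj₂ refl) ∷ _) ()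
nonzeros⇒WeakAlt Sign.- zero (inj₂ (inj₂ refl) ∷ _) ()
nonzeros⇒WeakAlt Sign.- (suc n) (inj₂ (inj₂ refl) ∷ _) ()

WeakAlt1⇔WeakAlt : WeakAlt1 xs ⇔ (∃[ s ] WeakAlt s xs)
WeakAlt1⇔WeakAlt = mk⇔ to from
  where
  to : WeakAlt1 xs → ∃[ s ] WeakAlt s xs
  to (ts , inj₁ e) = Sign.- , nonzeros⇒WeakAlt Sign.- _ ts e
  to (ts , inj₂ e) = Sign.+ , nonzeros⇒WeakAlt Sign.+ _ ts e
  from : ∃[ s ] WeakAlt s xs → WeakAlt1 xs
  from (Sign.- , w) = WeakAlt⇒trits w , inj₁ (WeakAlt⇒nonzeros w)
  from (Sign.+ , w) = WeakAlt⇒trits w , inj₂ (WeakAlt⇒nonzeros w)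

module _ {c ℓ₁ ℓ₂ : Level} (R : OrderedCommRing c ℓ₁ ℓ₂) where

  open OrderedCommRing R hiding (zero)
    renaming (refl to ≈-refl; sym to ≈-sym; trans to ≈-trans; _<_ to infix 4 _<_; _≤_ to infix 4 _≤_)
  open import Algebra.Properties.Ring ring using (-0#≈0#; -‿involutive; -‿+-comm; -‿distribʳ-*)

  open IsStrictTotalOrder isStrictTotalOrder
    using (isStrictPartialOrder; <-respˡ-≈; <-respʳ-≈) renaming (trans to <-trans; irrefl to <-irrefl)

  strictPartialOrder : StrictPartialOrder c ℓ₁ ℓ₂
  strictPartialOrder = record { isStrictPartialOrder = isStrictPartialOrder }

  open import Relation.Binary.Reasoning.StrictPartialOrder strictPartialOrder

  private
    variable
      u y z : Carrier

  +-monoʳ-< : y < z → u + y < u + z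
  +-monoʳ-< {y} {z} {u} y<z = begin-strict
    u + y ≈⟨ +-comm u y ⟩
    y + u <⟨ +-mono-< u y<z ⟩
    z + u ≈⟨ +-comm z u ⟩
    u + z ∎

  +-monoʳ-≤ : y ≤ z → u + y ≤ u + z
  +-monoʳ-≤ (inj₁ y<z) = inj₁ (+-monoʳ-< y<z)
  +-monoʳ-≤ (inj₂ y≈z) = inj₂ (+-cong ≈-refl y≈z)

  +-monoˡ-≤ : y ≤ z → y + u ≤ z + u
  +-monoˡ-≤ (inj₁ y<z) = inj₁ (+-mono-< _ y<z)
  +-monoˡ-≤ (inj₂ y≈z) = inj₂ (+-cong y≈z ≈-refl)

  -‿anti-mono-< : y < z → - z < - y
  -‿anti-mono-< {y} {z} y<z = begin-strict
    - z                 ≈⟨ +-identityˡ (- z) ⟨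
    0# + - z            ≈⟨ +-cong (-‿inverseʳ y) ≈-refl ⟨
    (y + - y) + - z     ≈⟨ +-assoc y (- y) (- z) ⟩
    y + (- y + - z)     <⟨ +-mono-< (- y + - z) y<z ⟩
    z + (- y + - z)     ≈⟨ +-cong ≈-refl (+-comm (- y) (- z)) ⟩
    z + (- z + - y)     ≈⟨ +-assoc z (- z) (- y) ⟨
    (z + - z) + - y     ≈⟨ +-cong (-‿inverseʳ z) ≈-refl ⟩
    0# + - y            ≈⟨ +-identityˡ (- y) ⟩
    - y                 ∎

  -‿anti-mono-≤ : y ≤ z → - z ≤ - y
  -‿anti-mono-≤ (inj₁ y<z) = inj₁ (-‿anti-mono-< y<z)
  -‿anti-mono-≤ (inj₂ y≈z) = inj₂ (-‿cong (≈-sym y≈z))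

  -1<0 : - 1# < 0#
  -1<0 = begin-strict
    - 1# <⟨ -‿anti-mono-< 0<1 ⟩
    - 0# ≈⟨ -0#≈0# ⟩
    0#   ∎

  y<u⇒0<u-y : y < u → 0# < u + - y
  y<u⇒0<u-y {y} {u} y<u = begin-strict
    0#      ≈⟨ -‿inverseʳ y ⟨
    y + - y <⟨ +-mono-< (- y) y<u ⟩
    u + - y ∎

  0<y⇒u-y<u : 0# < y → u + - y < u
  0<y⇒u-y<u {y} {u} 0<y = begin-strict
    u + - y <⟨ +-monoʳ-< (<-respʳ-≈ -0#≈0# (-‿anti-mono-< 0<y)) ⟩
    u + 0#  ≈⟨ +-identityʳ u ⟩
    u       ∎

  0≤fromℕ : ∀ n → 0# ≤ fromℕ n
  0≤fromℕ zero    = inj₂ ≈-refl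
  0≤fromℕ (suc n) = begin
    0#            <⟨ 0<1 ⟩
    1#            ≈⟨ +-identityʳ 1# ⟨
    1# + 0#       ≤⟨ +-monoʳ-≤ (0≤fromℕ n) ⟩
    1# + fromℕ n  ∎

  infixr 8 _·_
  _·_ : Sign → Carrier → Carrier
  Sign.+ · y = y
  Sign.- · y = - y

  ·-cong : ∀ s → y ≈ z → s · y ≈ s · z
  ·-cong Sign.+ y≈z = y≈z
  ·-cong Sign.- y≈z = -‿cong y≈z

  ·-zero : ∀ s → s · 0# ≈ 0#
  ·-zero Sign.+ = ≈-refl
  ·-zero Sign.- = -0#≈0#

  ·-distrib-+ : ∀ s → s · (y + z) ≈ s · y + s · z
  ·-distrib-+ Sign.+         = ≈-refl
  ·-distrib-+ {y} {z} Sign.- = ≈-sym (-‿+-comm y z)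

  ·-*ʳ : ∀ s → s · (y * z) ≈ y * s · z
  ·-*ʳ Sign.+         = ≈-refl
  ·-*ʳ {y} {z} Sign.- = -‿distribʳ-* y z

  ·-opposite : ∀ s → opposite s · y ≈ - (s · y)
  ·-opposite Sign.+     = ≈-refl
  ·-opposite {y} Sign.- = ≈-sym (-‿involutive y)

  ·-fromℤ-◃ : ∀ s n → s · fromℤ (s ◃ n) ≈ fromℕ n
  ·-fromℤ-◃ Sign.+ zero    = ≈-refl
  ·-fromℤ-◃ Sign.+ (suc n) = ≈-refl
  ·-fromℤ-◃ Sign.- zero    = -0#≈0#
  ·-fromℤ-◃ Sign.- (suc n) = -‿involutive (fromℕ (suc n))

  ∣_∣≤1 : Carrier → Set (ℓ₁ ⊔ ℓ₂)
  ∣ y ∣≤1 = (- 1# ≤ y) × (y ≤ 1#)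

  ∣∣≤1-resp-≈ : y ≈ z → ∣ y ∣≤1 → ∣ z ∣≤1
  ∣∣≤1-resp-≈ {y} {z} y≈z (-1≤y , y≤1) =
    (begin - 1# ≤⟨ -1≤y ⟩ y ≈⟨ y≈z ⟩ z ∎) , (begin z ≈⟨ y≈z ⟨ y ≤⟨ y≤1 ⟩ 1# ∎)

  ∣∣≤1⇒·≤1 : ∣ y ∣≤1 → ∀ s → s · y ≤ 1#
  ∣∣≤1⇒·≤1 (_ , y≤1)        Sign.+ = y≤1
  ∣∣≤1⇒·≤1 {y} (-1≤y , _) Sign.- = begin
    - y    ≤⟨ -‿anti-mono-≤ -1≤y ⟩
    - - 1# ≈⟨ -‿involutive 1# ⟩
    1#     ∎

  ·≤1⇒∣∣≤1 : (∀ s → s · y ≤ 1#) → ∣ y ∣≤1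
  ·≤1⇒∣∣≤1 {y} ·≤1 = -1≤y , ·≤1 Sign.+
    where
    -1≤y : - 1# ≤ y
    -1≤y = begin
      - 1#  ≤⟨ -‿anti-mono-≤ (·≤1 Sign.-) ⟩
      - - y ≈⟨ -‿involutive y ⟩
      y     ∎

  weightedSum : ∀ {n} → (Fin n → Carrier) → (Fin n → ℤ) → Carrier
  weightedSum b a = ∑ λ j → b j * fromℤ (a j)

  StrictlyDecreasing : ∀ {n} → (Fin n → Carrier) → Set ℓ₂
  StrictlyDecreasing b = ∀ {j k} → j Fin.< k → b k < b j

  SignedWithin : ∀ {n} → Sign → Carrier → (Fin n → Carrier) → Set (ℓ₁ ⊔ ℓ₂)
  SignedWithin s y b = 0# < s · y × ∃[ j ] s · y ≤ b j

  weightedSum-zeros : ∀ {n} (b : Fin n → Carrier) (a : Fin n → ℤ) →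
                      All (_≡ 0ℤ) (seq a) → weightedSum b a ≈ 0#
  weightedSum-zeros {zero}  b a []           = ≈-refl
  weightedSum-zeros {suc n} b a (a₀≡0 ∷ a≡0) = begin-equality
    b zero * fromℤ (a zero) + weightedSum (b ∘ suc) (a ∘ suc)
      ≈⟨ +-cong (*-cong ≈-refl (reflexive (cong fromℤ a₀≡0))) (weightedSum-zeros (b ∘ suc) (a ∘ suc) a≡0) ⟩
    b zero * 0# + 0# ≈⟨ +-identityʳ _ ⟩
    b zero * 0#      ≈⟨ zeroʳ _ ⟩
    0#               ∎

  -- As for an alternating series, the sum has the sign of its first nonzero term
  -- and is bounded by that term's weight.
  weightedSum-weakAlt : ∀ {n} (b : Fin n → Carrier) (a : Fin n → ℤ) →
    (∀ j → 0# < b j) → StrictlyDecreasing b → WeakAlt s (seq a) →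
    All (_≡ 0ℤ) (seq a) ⊎ SignedWithin s (weightedSum b a) b
  weightedSum-weakAlt {n = zero} _ _ _ _ _ = inj₁ []
  weightedSum-weakAlt {s} {suc n} b a b>0 b↓ w with uncons w
  ... | inj₁ (a₀≡0 , w′) = Sum.map (a₀≡0 ∷_) shift (weightedSum-weakAlt _ _ (b>0 ∘ suc) (b↓ ∘ s≤s) w′)
    where
    S≈S′ : s · weightedSum b a ≈ s · weightedSum (b ∘ suc) (a ∘ suc)
    S≈S′ = ·-cong s (begin-equality
      b zero * fromℤ (a zero) + weightedSum (b ∘ suc) (a ∘ suc)
        ≈⟨ +-cong (*-cong ≈-refl (reflexive (cong fromℤ a₀≡0))) ≈-refl ⟩
      b zero * 0# + weightedSum (b ∘ suc) (a ∘ suc) ≈⟨ +-cong (zeroʳ _) ≈-refl ⟩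
      0# + weightedSum (b ∘ suc) (a ∘ suc)          ≈⟨ +-identityˡ _ ⟩
      weightedSum (b ∘ suc) (a ∘ suc)               ∎)
    shift : SignedWithin s (weightedSum (b ∘ suc) (a ∘ suc)) (b ∘ suc) → SignedWithin s (weightedSum b a) b
    shift (0<S′ , j , S′≤b) = <-respʳ-≈ (≈-sym S≈S′) 0<S′ , suc j ,
      (begin s · weightedSum b a ≈⟨ S≈S′ ⟩ s · weightedSum (b ∘ suc) (a ∘ suc) ≤⟨ S′≤b ⟩ b (suc j) ∎)
  ... | inj₂ (a₀≡s , w′) = inj₂ (extend (weightedSum-weakAlt _ _ (b>0 ∘ suc) (b↓ ∘ s≤s) w′))
    where
    S′ : Carrier
    S′ = weightedSum (b ∘ suc) (a ∘ suc)
    S≈b₀+S′ : s · weightedSum b a ≈ b zero + s · S′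
    S≈b₀+S′ = begin-equality
      s · (b zero * fromℤ (a zero) + S′)   ≈⟨ ·-distrib-+ s ⟩
      s · (b zero * fromℤ (a zero)) + s · S′ ≈⟨ +-cong (·-*ʳ s) ≈-refl ⟩
      b zero * s · fromℤ (a zero) + s · S′ ≈⟨ +-cong (*-cong ≈-refl (·-cong s (reflexive (cong fromℤ a₀≡s)))) ≈-refl ⟩
      b zero * s · fromℤ (s ◃ 1) + s · S′  ≈⟨ +-cong (*-cong ≈-refl (·-fromℤ-◃ s 1)) ≈-refl ⟩
      b zero * (1# + 0#) + s · S′          ≈⟨ +-cong (*-cong ≈-refl (+-identityʳ 1#)) ≈-refl ⟩
      b zero * 1# + s · S′                 ≈⟨ +-cong (*-identityʳ _) ≈-refl ⟩
      b zero + s · S′                      ∎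
    extend : All (_≡ 0ℤ) (seq (a ∘ suc)) ⊎ SignedWithin (opposite s) S′ (b ∘ suc) →
             SignedWithin s (weightedSum b a) b
    extend (inj₁ a≡0) = <-respʳ-≈ (≈-sym S≈b₀) (b>0 zero) , zero , inj₂ S≈b₀
      where
      S≈b₀ : s · weightedSum b a ≈ b zero
      S≈b₀ = begin-equality
        s · weightedSum b a ≈⟨ S≈b₀+S′ ⟩
        b zero + s · S′     ≈⟨ +-cong ≈-refl (≈-trans (·-cong s (weightedSum-zeros _ _ a≡0)) (·-zero s)) ⟩
        b zero + 0#         ≈⟨ +-identityʳ _ ⟩
        b zero              ∎
    extend (inj₂ (0<v , j , v≤b)) = 0<S , zero , inj₁ S<b₀
      where
      v : Carrier
      v = opposite s · S′
      S≈b₀-v : s · weightedSum b a ≈ b zero + - v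
      S≈b₀-v = ≈-trans S≈b₀+S′ (+-cong ≈-refl (≈-trans (≈-sym (-‿involutive _)) (-‿cong (≈-sym (·-opposite s)))))
      0<S : 0# < s · weightedSum b a
      0<S = <-respʳ-≈ (≈-sym S≈b₀-v) (y<u⇒0<u-y (begin-strict v ≤⟨ v≤b ⟩ b (suc j) <⟨ b↓ (s≤s z≤n) ⟩ b zero ∎))
      S<b₀ : s · weightedSum b a < b zero
      S<b₀ = <-respˡ-≈ (≈-sym S≈b₀-v) (0<y⇒u-y<u 0<v)

  ∣0∣≤1 : ∣ 0# ∣≤1
  ∣0∣≤1 = inj₁ -1<0 , inj₁ 0<1

  weightedSum-weakAlt-∣∣≤1 : ∀ {n} (b : Fin n → Carrier) (a : Fin n → ℤ) →
    (∀ j → 0# < b j) → StrictlyDecreasing b → (∀ j → b j ≤ 1#) →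
    WeakAlt s (seq a) → ∣ weightedSum b a ∣≤1
  weightedSum-weakAlt-∣∣≤1 {s} b a b>0 b↓ b≤1 w with weightedSum-weakAlt b a b>0 b↓ w
  ... | inj₁ a≡0 = ∣∣≤1-resp-≈ (≈-sym (weightedSum-zeros b a a≡0)) ∣0∣≤1
  ... | inj₂ (0<S , j , S≤b) = ·≤1⇒∣∣≤1 ·S≤1
    where
    ·S≤1 : ∀ t → t · weightedSum b a ≤ 1#
    ·S≤1 t with same-or-opposite t s
    ... | inj₁ refl = begin t · weightedSum b a ≤⟨ S≤b ⟩ b j ≤⟨ b≤1 j ⟩ 1# ∎
    ... | inj₂ refl = inj₁ (begin-strict
      opposite s · weightedSum b a ≈⟨ ·-opposite s ⟩
      - (s · weightedSum b a)      <⟨ -‿anti-mono-< 0<S ⟩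
      - 0#                         ≈⟨ -0#≈0# ⟩
      0#                           <⟨ 0<1 ⟩
      1#                           ∎)

  weightedSum-weakAlt-<1 : ∀ {n} (b : Fin n → Carrier) (a : Fin n → ℤ) →
    (∀ j → 0# < b j) → StrictlyDecreasing b → (∀ j → b j < 1#) → WeakAlt s (seq a) →
    (weightedSum b a ≈ 0# × All (_≡ 0ℤ) (seq a)) ⊎ (0# < s · weightedSum b a × s · weightedSum b a < 1#)
  weightedSum-weakAlt-<1 {s} b a b>0 b↓ b<1 w with weightedSum-weakAlt b a b>0 b↓ w
  ... | inj₁ a≡0 = inj₁ (weightedSum-zeros b a a≡0 , a≡0)
  ... | inj₂ (0<S , j , S≤b) = inj₂ (0<S , (begin-strict s · weightedSum b a ≤⟨ S≤b ⟩ b j <⟨ b<1 j ⟩ 1# ∎))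

  overshoot : ∀ s n → 0# < fromℕ n + s · y → ¬ ∣ fromℤ (s ◃ suc n) + y ∣≤1
  overshoot {y} s n 0<n+y bnd = <-irrefl ≈-refl (begin-strict
    1#                            ≈⟨ +-identityʳ 1# ⟨
    1# + 0#                       <⟨ +-monoʳ-< 0<n+y ⟩
    1# + (fromℕ n + s · y)        ≈⟨ +-assoc 1# _ _ ⟨
    fromℕ (suc n) + s · y         ≈⟨ +-cong (·-fromℤ-◃ s (suc n)) ≈-refl ⟨
    s · fromℤ (s ◃ suc n) + s · y ≈⟨ ·-distrib-+ s ⟨
    s · (fromℤ (s ◃ suc n) + y)   ≤⟨ ∣∣≤1⇒·≤1 bnd s ⟩
    1#                            ∎)

  0<fromℕ-suc+ : ∀ n → - 1# < y → 0# < fromℕ (suc n) + y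
  0<fromℕ-suc+ {y} n -1<y = begin-strict
    0#                ≈⟨ -‿inverseʳ 1# ⟨
    1# + - 1#         <⟨ +-monoʳ-< -1<y ⟩
    1# + y            ≈⟨ +-cong (+-identityʳ 1#) ≈-refl ⟨
    (1# + 0#) + y     ≤⟨ +-monoˡ-≤ (+-monoʳ-≤ (0≤fromℕ n)) ⟩
    fromℕ (suc n) + y ∎

  -1<· : ∀ t → y ≈ 0# ⊎ (0# < t · y × t · y < 1#) → ∀ s → - 1# < s · y
  -1<· t (inj₁ y≈0) s = <-respʳ-≈ (≈-sym (≈-trans (·-cong s y≈0) (·-zero s))) -1<0
  -1<· t (inj₂ (0<ty , ty<1)) s with same-or-opposite s t
  ... | inj₁ refl = <-trans -1<0 0<ty
  ... | inj₂ refl = <-respʳ-≈ (≈-sym (·-opposite t)) (-‿anti-mono-< ty<1)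

  -- |x| ≥ 2, and x = t unless y = 0, would give |x + y| > 1.
  weakAlt-∷ : ∀ x → WeakAlt t xs →
    (y ≈ 0# × All (_≡ 0ℤ) xs) ⊎ (0# < t · y × t · y < 1#) →
    ∣ fromℤ x + y ∣≤1 → ∃[ s ] WeakAlt s (x ∷ xs)
  weakAlt-∷ {t} {xs} {y} x w tail bnd with signAbs x
  ... | s ◂ zero        = t , 0∷ w
  ... | s ◂ suc (suc n) =
    ⊥-elim (overshoot s (suc n) (0<fromℕ-suc+ n (-1<· t (Sum.map₁ proj₁ tail) s)) bnd)
  ... | s ◂ 1 with tail | same-or-opposite s t
  ...   | inj₁ (_ , xs≡0) | _ = s , ±1∷ zeros⇒WeakAlt xs≡0
  ...   | inj₂ (0<ty , _) | inj₁ refl = ⊥-elim (overshoot s 0 (<-respʳ-≈ (≈-sym (+-identityˡ _)) 0<ty) bnd)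
  ...   | inj₂ _ | inj₂ refl = s , ±1∷ subst (λ r → WeakAlt r xs) (sym (opposite-involutive t)) w

  lowerRight : ∀ {d} → Matrix (suc d) → Matrix d
  lowerRight A i j = A (suc i) (suc j)

  Reclusive-lowerRight : ∀ {d} {A : Matrix (suc d)} → Reclusive A → Reclusive (lowerRight A)
  Reclusive-lowerRight (lower , diag , dec) =
    (λ i j j<i → lower (suc i) (suc j) (s≤s j<i)) , diag ∘ suc ,
    (λ i j k i≤j j<k → dec (suc i) (suc j) (suc k) (s≤s i≤j) (s≤s j<k))

  mulVec-suc : ∀ {d} {A : Matrix (suc d)} (a : Fin (suc d) → ℤ) → Reclusive A →
               ∀ i → mulVec A a (suc i) ≈ mulVec (lowerRight A) (a ∘ suc) i
  mulVec-suc {A = A} a (lower , _) i = begin-equality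
    A (suc i) zero * fromℤ (a zero) + mulVec (lowerRight A) (a ∘ suc) i
      ≈⟨ +-cong (*-cong (lower (suc i) zero (s≤s z≤n)) ≈-refl) ≈-refl ⟩
    0# * fromℤ (a zero) + mulVec (lowerRight A) (a ∘ suc) i ≈⟨ +-cong (zeroˡ _) ≈-refl ⟩
    0# + mulVec (lowerRight A) (a ∘ suc) i                  ≈⟨ +-identityˡ _ ⟩
    mulVec (lowerRight A) (a ∘ suc) i                       ∎

  mulVec-zero : ∀ {d} {A : Matrix (suc d)} (a : Fin (suc d) → ℤ) → Reclusive A →
                mulVec A a zero ≈ fromℤ (a zero) + weightedSum (A zero ∘ suc) (a ∘ suc)
  mulVec-zero a (_ , diag , _) = +-cong (≈-trans (*-cong (diag zero) ≈-refl) (*-identityˡ _)) ≈-refl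

  firstRow-tail<1 : ∀ {d} {A : Matrix (suc d)} → Reclusive A → ∀ j → A zero (suc j) < 1#
  firstRow-tail<1 (_ , diag , dec) j = <-respʳ-≈ (diag zero) (proj₁ (dec zero zero (suc j) z≤n (s≤s z≤n)))

  firstRow-≤1 : ∀ {d} {A : Matrix (suc d)} → Reclusive A → ∀ j → A zero j ≤ 1#
  firstRow-≤1 (_ , diag , _) zero    = inj₂ (diag zero)
  firstRow-≤1 rec            (suc j) = inj₁ (firstRow-tail<1 rec j)

  firstRow-positive : ∀ {d} {A : Matrix (suc d)} → Reclusive A → ∀ j → 0# < A zero j
  firstRow-positive (_ , diag , _) zero    = <-respʳ-≈ (≈-sym (diag zero)) 0<1
  firstRow-positive (_ , _ , dec)  (suc j) = proj₂ (dec zero zero (suc j) z≤n (s≤s z≤n))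

  firstRow-decreasing : ∀ {d} {A : Matrix (suc d)} → Reclusive A → StrictlyDecreasing (A zero)
  firstRow-decreasing (_ , _ , dec) {j} {k} j<k = proj₁ (dec zero j k z≤n j<k)

  weakAlt⇒bounded : ∀ {d} (A : Matrix d) (a : Fin d → ℤ) → Reclusive A →
                    WeakAlt s (seq a) → InfNorm≤1 (mulVec A a)
  weakAlt⇒bounded A a rec w zero =
    weightedSum-weakAlt-∣∣≤1 (A zero) a (firstRow-positive rec) (firstRow-decreasing rec) (firstRow-≤1 rec) w
  weakAlt⇒bounded A a rec w (suc i) =
    ∣∣≤1-resp-≈ (≈-sym (mulVec-suc a rec i))
      (weakAlt⇒bounded (lowerRight A) (a ∘ suc) (Reclusive-lowerRight rec) (proj₂ (WeakAlt-tail w)) i)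

  bounded⇒weakAlt : ∀ {d} (A : Matrix d) (a : Fin d → ℤ) → Reclusive A →
                    InfNorm≤1 (mulVec A a) → ∃[ s ] WeakAlt s (seq a)
  bounded⇒weakAlt {zero}  A a rec bnd = Sign.+ , []
  bounded⇒weakAlt {suc d} A a rec bnd =
    let (t , w) = bounded⇒weakAlt (lowerRight A) (a ∘ suc) (Reclusive-lowerRight rec)
                    (λ i → ∣∣≤1-resp-≈ (mulVec-suc a rec i) (bnd (suc i)))
    in weakAlt-∷ (a zero) w
         (weightedSum-weakAlt-<1 (A zero ∘ suc) (a ∘ suc)
           (firstRow-positive rec ∘ suc) (firstRow-decreasing rec ∘ s≤s) (firstRow-tail<1 rec) w)
         (∣∣≤1-resp-≈ (mulVec-zero a rec) (bnd zero))

mainTheorem18 : ∀ {c ℓ₁ ℓ₂ : Level} (R : OrderedCommRing c ℓ₁ ℓ₂) (d : ℕ)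
    (A : OrderedCommRing.Matrix R d) → OrderedCommRing.Reclusive R A →
    (cv : Fin d → ℤ) →
    (OrderedCommRing.InfNorm≤1 R (OrderedCommRing.mulVec R A cv) ⇔ WeakAlt1 (seq cv))
mainTheorem18 R d A rec cv = mk⇔
  (λ bnd → Equivalence.from WeakAlt1⇔WeakAlt (bounded⇒weakAlt R A cv rec bnd))
  (λ alt → weakAlt⇒bounded R A cv rec (proj₂ (Equivalence.to WeakAlt1⇔WeakAlt alt)))
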